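{- Let $\mathcal R$ be a left-linear TRS such that its duplicating rules $\mathcal R_{\mathsf d}$ terminate relative to its non-duplicating rules $\mathcal R_{\mathsf{nd}}$. Suppose there is an index mapping $i\colon\mathcal R\to\mathbb N$ such that every critical peak of $\mathcal R$ has a local diagram that has the fan property and is decreasing for the rule labeling $\ell^i$ (with labels compared by $>_{\mathbb N}$ and $\geqslant_{\mathbb N}$). Then $\mathcal R$ is confluent.
   Context: Terms over a signature and variables $\mathcal V$; $\mathcal{F}\mathrm{Pos}(t)$ is the set of positions $p$ of $t$ with $t|_p\notin\mathcal V$; $s[t]_p$ is replacement at position $p$. A TRS is a set of rules $l\to r$ (no variable conditions imposed); it is left-linear if no variable occurs more than once in any left-hand side; it is confluent if ${}^*\!\leftarrow\cdot\to^*\subseteq\to^*\cdot{}^*\!\leftarrow$. A rule $l\to r$ is duplicating if $|l|_x<|r|_x$ for some variable $x$ ($|t|_x$ = number of occurrences of $x$ in $t$); $\mathcal R_{\mathsf d}$ and $\mathcal R_{\mathsf{nd}}$ are the duplicating and non-duplicating rules of $\mathcal R$. $\mathcal R_{\mathsf d}$ terminates relative to $\mathcal R_{\mathsf{nd}}$ if $\to^*_{\mathcal R_{\mathsf{nd}}}\cdot\to_{\mathcal R_{\mathsf d}}\cdot\to^*_{\mathcal R_{\mathsf{nd}}}$ is well-founded. A rewrite step $s\to^\pi t$ with $\pi=\langle p,l\to r,\sigma\rangle$ means $l\to r\in\mathcal R$, $s|_p=l\sigma$, $t=s[r\sigma]_p$; $t\leftarrow^\pi s$ is its inverse. The rule labeling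 assigns to a step (forward or backward) using rule $l\to r$ the label $i(l\to r)$. A critical overlap $(l_1\to r_1,p,l_2\to r_2)_\mu$ consists of variants of rules of $\mathcal R$ without common variables, a position $p\in\mathcal{F}\mathrm{Pos}(l_2)$ and a most general unifier $\mu$ of $l_1$ and $l_2|_p$ (root overlaps of a rule with a variant of itself are not excluded); it yields the critical peak $t\leftarrow s\to u$ with $s=l_2\mu$, $t=l_2\mu[r_1\mu]_p$ (step using $l_1\to r_1$, label $\alpha=i(l_1\to r_1)$) and $u=r_2\mu$ (step using $l_2\to r_2$, label $\beta=i(l_2\to r_2)$). A local diagram for this peak is a conversion $t\leftrightarrow^*t'\to^=t''\leftrightarrow^*u''\leftarrow^=u'\leftrightarrow^*u$; it is decreasing for $\ell^i$ if every step of $t\leftrightarrow^*t'$ has label $<\alpha$, the step $t'\to^=t''$ (if present) has label $\leqslant\beta$, every step of $t''\leftrightarrow^*u''$ has label $<\alpha$ or $<\beta$, the step $u''\leftarrow^=u'$ (if present) has label $\leqslant\alpha$, and every step of $u'\leftrightarrow^*u$ has label $<\beta$. Writing the whole conversion of the local diagram as $t=t_1\leftrightarrow t_2\leftrightarrow\cdots\leftrightarrow t_n=u$, the diagram has the fan property if $s\to^*_{\mathcal R}t_j$ for all $1\leqslant j\leqslant n$. -}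

module Defs where

open import Data.Nat using (ℕ; zero; suc; _+_; _≤_; _<_; _≡ᵇ_)
open import Data.Bool using (if_then_else_)
open import Data.Vec using (Vec; []; _∷_)
open import Data.List using (List; []; _∷_)
open import Data.Maybe using (Maybe; just; nothing)
open import Data.Product using (Σ; ∃; _×_; _,_)
open import Data.Sum using (_⊎_)
open import Function using (_∘_)
open import Function.Bundles using (_↔_; Inverse)
open import Relation.Binary.PropositionalEquality using (_≡_)
open import Relation.Nullary using (¬_)
open import Induction.WellFounded using (WellFounded)
open import Relation.Binary.Construct.Closure.ReflexiveTransitive using (Star)

record Signature : Set₁ where
  field
    Fun   : Set
    arity : Fun → ℕ

module Rewriting (Sig : Signature) where
  open Signature Sig

  Var : Set
  Var = ℕ

  data Term : Set where
    var : Var → Term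
    fun : (f : Fun) → Vec Term (arity f) → Term

  Subst : Set
  Subst = Var → Term

  mutual
    _⟨_⟩ : Term → Subst → Term
    var x    ⟨ σ ⟩ = σ x
    fun f ts ⟨ σ ⟩ = fun f (ts ⟨ σ ⟩*)

    _⟨_⟩* : ∀ {n} → Vec Term n → Subst → Vec Term n
    []       ⟨ σ ⟩* = []
    (t ∷ ts) ⟨ σ ⟩* = (t ⟨ σ ⟩) ∷ (ts ⟨ σ ⟩*)

  mutual
    count : Var → Term → ℕ
    count x (var y)    = if x ≡ᵇ y then 1 else 0
    count x (fun f ts) = count* x ts

    count* : ∀ {n} → Var → Vec Term n → ℕ
    count* x []       = 0
    count* x (t ∷ ts) = count x t + count* x ts

  -- Positions: lists of (0-based) argument indices.
  Pos : Set
  Pos = List ℕ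

  mutual
    _at_ : Term → Pos → Maybe Term
    t        at []      = just t
    var x    at (_ ∷ _) = nothing
    fun f ts at (i ∷ p) = atVec ts i p

    atVec : ∀ {n} → Vec Term n → ℕ → Pos → Maybe Term
    atVec []       i       p = nothing
    atVec (t ∷ ts) zero    p = t at p
    atVec (t ∷ ts) (suc i) p = atVec ts i p

  -- s[t]_p (only used when p is a position of s)
  mutual
    replace : Term → Pos → Term → Term
    replace s          []      t = t
    replace (var x)    (_ ∷ _) t = var x
    replace (fun f ts) (i ∷ p) t = fun f (replaceVec ts i p t)

    replaceVec : ∀ {n} → Vec Term n → ℕ → Pos → Term → Vec Term n
    replaceVec []       i       p t = []
    replaceVec (s ∷ ss) zero    p t = replace s p t ∷ ss
    replaceVec (s ∷ ss) (suc i) p t = s ∷ replaceVec ss i p t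

  IsFun : Term → Set
  IsFun t = ∃ λ f → ∃ λ ts → t ≡ fun f ts

  -- Rules (no variable conditions imposed) and TRSs (arbitrary sets of rules)
  record Rule : Set where
    constructor _⇒_
    field
      lhs : Term
      rhs : Term
  open Rule public

  TRS : Set₁
  TRS = Rule → Set

  LeftLinear : TRS → Set
  LeftLinear R = ∀ ρ → R ρ → ∀ x → count x (lhs ρ) ≤ 1

  Duplicating : Rule → Set
  Duplicating ρ = ∃ λ x → count x (lhs ρ) < count x (rhs ρ)

  DupRules : TRS → TRS
  DupRules R ρ = R ρ × Duplicating ρ

  NonDupRules : TRS → TRS
  NonDupRules R ρ = R ρ × ¬ Duplicating ρ

  Step : TRS → Rule → Term → Term → Set
  Step R ρ s t = R ρ × Σ Pos λ p → Σ Subst λ σ →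
                 (s at p ≡ just (lhs ρ ⟨ σ ⟩)) × (t ≡ replace s p (rhs ρ ⟨ σ ⟩))

  _⊢_⟶_ : TRS → Term → Term → Set
  R ⊢ s ⟶ t = ∃ λ ρ → Step R ρ s t

  _⊢_⟶*_ : TRS → Term → Term → Set
  R ⊢ s ⟶* t = Star (R ⊢_⟶_) s t

  Confluent : TRS → Set
  Confluent R = ∀ {s t u} → R ⊢ s ⟶* t → R ⊢ s ⟶* u →
                ∃ λ v → (R ⊢ t ⟶* v) × (R ⊢ u ⟶* v)

  RelStep : TRS → TRS → Term → Term → Set
  RelStep D N s t = ∃ λ s₁ → ∃ λ t₁ →
                    (N ⊢ s ⟶* s₁) × (D ⊢ s₁ ⟶ t₁) × (N ⊢ t₁ ⟶* t)

  RelTerminating : TRS → TRS → Set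
  RelTerminating D N = WellFounded (λ t s → RelStep D N s t)

  rename : (Var → Var) → Rule → Rule
  rename θ ρ = (lhs ρ ⟨ var ∘ θ ⟩) ⇒ (rhs ρ ⟨ var ∘ θ ⟩)

  Variant : Rule → Rule → Set
  Variant ρ′ ρ = Σ (Var ↔ Var) λ θ → ρ′ ≡ rename (Inverse.to θ) ρ

  OccursIn : Var → Rule → Set
  OccursIn x ρ = 0 < count x (lhs ρ) + count x (rhs ρ)

  MGU : Subst → Term → Term → Set
  MGU μ a b = (a ⟨ μ ⟩ ≡ b ⟨ μ ⟩) ×
              (∀ ν → a ⟨ ν ⟩ ≡ b ⟨ ν ⟩ → ∃ λ δ → ∀ x → ν x ≡ (μ x) ⟨ δ ⟩)

  record CriticalOverlap (R : TRS) (ρ₁ ρ₂ ρ₁′ ρ₂′ : Rule) (p : Pos) (μ : Subst) : Set where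
    field
      ρ₁∈R      : R ρ₁
      ρ₂∈R      : R ρ₂
      variant₁  : Variant ρ₁′ ρ₁
      variant₂  : Variant ρ₂′ ρ₂
      disjoint  : ∀ x → OccursIn x ρ₁′ → ¬ OccursIn x ρ₂′
      subterm   : Term
      at-p      : lhs ρ₂′ at p ≡ just subterm
      nonvar    : IsFun subterm
      mgu       : MGU μ (lhs ρ₁′) subterm

  data Conv (R : TRS) (i : Rule → ℕ) (P : ℕ → Set) (Q : Term → Set) : Term → Term → Set where
    ε   : ∀ {t} → Q t → Conv R i P Q t t
    fwd : ∀ {s t u} ρ → Step R ρ s t → P (i ρ) → Q s → Conv R i P Q t u → Conv R i P Q s u
    bwd : ∀ {s t u} ρ → Step R ρ t s → P (i ρ) → Q s → Conv R i P Q t u → Conv R i P Q s u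

  OptStep : (R : TRS) (i : Rule → ℕ) (P : ℕ → Set) → Term → Term → Set
  OptStep R i P s t = (s ≡ t) ⊎ (∃ λ ρ → Step R ρ s t × P (i ρ))

  -- A local diagram  t ↔* t′ →^= t″ ↔* u″ ←^= u′ ↔* u  for the peak t ← s → u
  -- (labels α of the left step, β of the right step) that is decreasing for
  -- the rule labeling ℓ^i and has the fan property (s →* tⱼ for all tⱼ).
  DecreasingFanDiagram : TRS → (Rule → ℕ) → (s t u : Term) (α β : ℕ) → Set
  DecreasingFanDiagram R i s t u α β =
    ∃ λ t′ → ∃ λ t″ → ∃ λ u″ → ∃ λ u′ →
      Conv R i (_< α) Q t t′ ×
      OptStep R i (_≤ β) t′ t″ ×
      Conv R i (λ n → (n < α) ⊎ (n < β)) Q t″ u″ ×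
      OptStep R i (_≤ α) u′ u″ ×
      Conv R i (_< β) Q u′ u
    where
      Q : Term → Set
      Q x = R ⊢ s ⟶* x

  CriticalPeaksDecreasingFan : TRS → (Rule → ℕ) → Set
  CriticalPeaksDecreasingFan R i =
    ∀ ρ₁ ρ₂ ρ₁′ ρ₂′ p μ → CriticalOverlap R ρ₁ ρ₂ ρ₁′ ρ₂′ p μ →
      DecreasingFanDiagram R i
        (lhs ρ₂′ ⟨ μ ⟩)
        (replace (lhs ρ₂′ ⟨ μ ⟩) p (rhs ρ₁′ ⟨ μ ⟩))
        (rhs ρ₂′ ⟨ μ ⟩)
        (i ρ₁) (i ρ₂)

{-# OPTIONS --safe #-}

-- Decreasing diagrams with labels in ℕ suffice.  By well-founded induction on the
-- relative rewrite relation, fix s such that every term reached from s by a reduction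
-- with at least one duplicating step is confluent; call these terms small.  On the terms
-- reachable from s, label a step 0 if its source is small, and 1 + i ρ in any case, where ρ is
-- its rule.  The 0-labelled steps are confluent by the induction hypothesis.  A critical
-- peak is closed by an instance of its given diagram; the fan property keeps all sources
-- reachable from s, so that its steps may be labelled.  A variable overlap is
-- joined with one step on either side unless the outer rule duplicates the variable, and
-- then the result of the outer step is small, so that the copies of the inner step get label 0.
module Submission where

open import Defs
open import Algebra.Properties.CommutativeSemigroup using (interchange)
open import Data.Bool using (true; false; if_then_else_)
open import Data.List using ([]; _∷_)
open import Data.Maybe using (just)
open import Data.Maybe.Properties using (just-injective)
open import Data.Nat using (ℕ; zero; suc; _+_; _∸_; _≤_; _<_; _⊔_; _≡ᵇ_; _≟_; _≤?_; _<?_; z≤n; s≤s)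
open import Data.Nat.Properties hiding (_≟_; _≤?_; _<?_)
open import Data.Product using (Σ; ∃; ∃₂; _×_; _,_; proj₁; proj₂)
open import Data.Sum using (_⊎_; inj₁; inj₂; [_,_])
open import Data.Vec using (Vec; []; _∷_)
open import Data.Vec.Properties using (∷-injectiveˡ; ∷-injectiveʳ)
open import Function using (_∘_; id; _↔_; mk↔ₛ′)
open import Function.Construct.Identity using (↔-id)
open import Induction.WellFounded using (Acc; acc)
open import Relation.Binary.Construct.Closure.Equivalence using (EqClosure)
open import Relation.Binary.Construct.Closure.ReflexiveTransitive using (Star; ε; _◅_; _◅◅_)
open import Relation.Binary.Construct.Closure.Symmetric using (fwd; bwd)
open import Relation.Binary.PropositionalEquality using (_≡_; _≢_; refl; sym; trans; cong; cong₂; subst; subst₂)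
open import Relation.Nullary using (¬_; Dec; yes; no; contradiction)
import Relation.Binary.Construct.Closure.Equivalence as Eq
import Relation.Binary.Construct.Closure.ReflexiveTransitive as Star
import Relation.Nullary.Decidable as Dec

-- Decreasing diagrams

module Labelled {A : Set} (S : ℕ → A → A → Set) where

  Below : ℕ → A → A → Set
  Below k a b = ∃ λ m → m < k × S m a b

  Red Conv : ℕ → A → A → Set
  Red k  = Star (Below k)
  Conv k = EqClosure (Below k)

  ChurchRosser : ℕ → Set
  ChurchRosser k = ∀ {a b} → Conv k a b → ∃ λ c → Red k a c × Red k b c

  -- `m` and `n` label the steps to `t` and `u`. A label is below `m ⊔ n` exactly if it is below one
  -- of them, and `Below (suc n)` admits labels up to `n`.
  Diagram : ℕ → ℕ → A → A → Set
  Diagram m n t u = ∃₂ λ t′ t″ → ∃₂ λ u″ u′ →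
    Conv m t t′ × (t′ ≡ t″ ⊎ Below (suc n) t′ t″) ×
    Conv (m ⊔ n) t″ u″ ×
    (u′ ≡ u″ ⊎ Below (suc m) u′ u″) × Conv n u′ u

  reverse : ∀ {k a b} → Conv k a b → Conv k b a
  reverse = Eq.symmetric _

  weakenBelow : ∀ {k l a b} → k ≤ l → Below k a b → Below l a b
  weakenBelow k≤l (m , m<k , s) = m , <-≤-trans m<k k≤l , s

  weakenRed : ∀ {k l a b} → k ≤ l → Red k a b → Red l a b
  weakenRed k≤l = Star.map (weakenBelow k≤l)

  weaken : ∀ {k l a b} → k ≤ l → Conv k a b → Conv l a b
  weaken k≤l = Eq.map (weakenBelow k≤l)

  Red⇒Conv : ∀ {k a b} → Red k a b → Conv k a b
  Red⇒Conv = Star.map fwd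

  flip-Diagram : ∀ {m n t u} → Diagram m n t u → Diagram n m u t
  flip-Diagram {m} {n} (t′ , t″ , u″ , u′ , c₁ , o₁ , c₂ , o₂ , c₃) =
    u′ , u″ , t″ , t′ , reverse c₃ , o₂ ,
    weaken (≤-reflexive (⊔-comm m n)) (reverse c₂) , o₁ , reverse c₁

module _ {A B : Set} {S : ℕ → A → A → Set} {T : ℕ → B → B → Set} (F : A → B)
         (F-step : ∀ {n a b} → S n a b → T n (F a) (F b)) where
  private
    module S = Labelled S
    module T = Labelled T

  map-Below : ∀ {k a b} → S.Below k a b → T.Below k (F a) (F b)
  map-Below (m , m<k , s) = m , m<k , F-step s

  -- Serves twice: with `F` an instantiation or a context to lift diagrams, and with `F = id` to
  -- change the labelling.
  map-Diagram : ∀ {m n t u} → S.Diagram m n t u → T.Diagram m n (F t) (F u)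
  map-Diagram (t′ , t″ , u″ , u′ , c₁ , o₁ , c₂ , o₂ , c₃) =
    F t′ , F t″ , F u″ , F u′ , conv c₁ , opt o₁ , conv c₂ , opt o₂ , conv c₃
    where
    conv : ∀ {k a b} → S.Conv k a b → T.Conv k (F a) (F b)
    conv = Eq.gmap F map-Below
    opt : ∀ {k a b} → a ≡ b ⊎ S.Below k a b → F a ≡ F b ⊎ T.Below k (F a) (F b)
    opt (inj₁ refl) = inj₁ refl
    opt (inj₂ s)    = inj₂ (map-Below s)

-- Peaks of two steps labelled 0 fall to `base`; `peak` is asked only where the larger label is
-- positive.
module Decreasing {A : Set} (S : ℕ → A → A → Set)
  (base : Labelled.ChurchRosser S 1)
  (peak : ∀ {m n a b c} → m ≤ n → 0 < n → S m a b → S n a c →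
          Labelled.Diagram S m n b c) where

  open Labelled S

  Opt : ℕ → A → A → Set
  Opt n a b = a ≡ b ⊎ S n a b

  -- t ↔*_{<k} · →_n^= · ↔*_{<n} u
  Slide : ℕ → ℕ → A → A → Set
  Slide n k t u = ∃₂ λ x y → Conv k t x × Opt n x y × Conv n y u

  step⇒Conv : ∀ {m k a b} → m < k → S m a b → Conv k a b
  step⇒Conv m<k s = fwd (_ , m<k , s) ◅ ε

  Opt⇒Conv : ∀ {n k a b} → n < k → Opt n a b → Conv k a b
  Opt⇒Conv n<k (inj₁ refl) = ε
  Opt⇒Conv n<k (inj₂ s)    = step⇒Conv n<k s

  prepend : ∀ {n k a b c} → Conv k a b → Slide n k b c → Slide n k a c
  prepend c (x , y , d , o , e) = x , y , c ◅◅ d , o , e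

  append : ∀ {n k a b c} → Slide n k a b → Conv n b c → Slide n k a c
  append (x , y , d , o , e) c = x , y , d , o , e ◅◅ c

  Conv⇒Slide : ∀ {n k a b} → Conv n a b → Slide n k a b
  Conv⇒Slide {a = a} c = a , a , ε , inj₁ refl , c

  splitBelow : ∀ {n a b} → Below (suc n) a b → Below n a b ⊎ S n a b
  splitBelow {n} (m , s≤s m≤n , s) with m≤n⇒m<n∨m≡n m≤n
  ... | inj₁ m<n  = inj₁ (m , m<n , s)
  ... | inj₂ refl = inj₂ s

  optSlide : ∀ {n a b} → a ≡ b ⊎ Below (suc n) a b → ∃₂ λ x y → a ≡ x × Opt n x y × Conv n y b
  optSlide (inj₁ refl) = _ , _ , refl , inj₁ refl , ε
  optSlide (inj₂ s) with splitBelow s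
  ... | inj₁ s<n = _ , _ , refl , inj₁ refl , fwd s<n ◅ ε
  ... | inj₂ s≡n = _ , _ , refl , inj₂ s≡n , ε

  -- As `m < n`, all that follows the first optional step of the diagram has labels below `n` and
  -- melts into one conversion.
  peak< : ∀ {m n a b c} → m < n → S m a b → S n a c → Slide n m b c
  peak< {m} {n} m<n s₁ s₂ with peak (<⇒≤ m<n) (≤-<-trans z≤n m<n) s₁ s₂
  ... | t′ , t″ , u″ , u′ , c₁ , o₁ , c₂ , o₂ , c₃ with optSlide o₁
  ...   | x , y , refl , o , d =
    x , y , c₁ , o , d ◅◅ weaken (⊔-lub (<⇒≤ m<n) ≤-refl) c₂ ◅◅ reverse (opt o₂) ◅◅ c₃
    where
    opt : ∀ {a b} → a ≡ b ⊎ Below (suc m) a b → Conv n a b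
    opt (inj₁ refl) = ε
    opt (inj₂ s)    = weaken m<n (fwd s ◅ ε)

  peak≡ : ∀ {n a b c} → 0 < n → S n a b → S n a c → ∃ λ v → Slide n n b v × Slide n n c v
  peak≡ {n} 0<n s₁ s₂ with peak ≤-refl 0<n s₁ s₂
  ... | t′ , t″ , u″ , u′ , c₁ , o₁ , c₂ , o₂ , c₃ with optSlide o₁ | optSlide o₂
  ...   | x , y , refl , o , d | x₂ , y₂ , refl , o′ , d′ =
    -- The slides meet at the left end of the middle conversion, which is charged to the right-hand
    -- slide since `n ⊔ n` is `n`.
    t″ , (x , y , c₁ , o , d) ,
    (x₂ , y₂ , reverse c₃ , o′ , d′ ◅◅ weaken (⊔-lub ≤-refl ≤-refl) (reverse c₂))

  -- Induction step on the label bound: slides around an `N`-step have the diamond property, so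
  -- conversions with labels up to `N` are joined by sequences of slides. Reductions simulate these
  -- up to a conversion below `N`, which `cr` joins.
  module Level (N : ℕ) (0<N : 0 < N) (cr : ∀ k → k ≤ N → ChurchRosser k) where

    -- Joining the conversion s ↔*_{<m+1} s₁ and sliding both steps along the two
    -- reductions to the common reduct leaves only a conversion with labels below m between them.
    mutual
      diamond< : ∀ m {k n s t s₁ s₂} → m ≤ k → k < n → n ≤ N →
                 S n s t → Conv m s s₁ → S k s₁ s₂ → Slide n k s₂ t
      -- No label is below 0, so the conversion is empty and the two steps form a local peak.
      diamond< zero m≤k k<n n≤N p c q with cr 0 z≤n c
      ... | _ , ε , ε = peak< k<n q p
      ... | _ , (_ , () , _) ◅ _ , _
      ... | _ , ε , (_ , () , _) ◅ _
      diamond< (suc m) m<k k<n n≤N p c q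
        with cr (suc m) (≤-trans m<k (≤-trans (<⇒≤ k<n) n≤N)) c
      ... | v , r₁ , r₂
        with slide m (<-trans m<k k<n) n≤N p ε r₁
           | slide m m<k (≤-trans (<⇒≤ k<n) n≤N) q ε r₂
      ...   | x₁ , y₁ , d₁ , inj₁ refl , e₁ | x₂ , y₂ , d₂ , o , e₂ =
        Conv⇒Slide (weaken (<⇒≤ k<n) (reverse e₂) ◅◅ reverse (Opt⇒Conv k<n o) ◅◅
          weaken (<⇒≤ (<-trans m<k k<n)) (reverse d₂ ◅◅ d₁) ◅◅ e₁)
      ...   | x₁ , y₁ , d₁ , inj₂ p′ , e₁ | x₂ , y₂ , d₂ , inj₁ refl , e₂ =
        x₁ , y₁ , reverse e₂ ◅◅ weaken (<⇒≤ m<k) (reverse d₂ ◅◅ d₁) , inj₂ p′ , e₁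
      ...   | x₁ , y₁ , d₁ , inj₂ p′ , e₁ | x₂ , y₂ , d₂ , inj₂ q′ , e₂ =
        prepend (reverse e₂)
          (append (diamond< m (<⇒≤ m<k) k<n n≤N p′ (reverse d₁ ◅◅ d₂) q′) e₁)

      -- Induction on the reduction. Steps below `m` are absorbed into the conversion from the
      -- source of the `n`-step; a step labelled `m` is passed by `diamond<`, which again leaves a
      -- conversion below `m` in front of the `n`-step.
      slide : ∀ m {n s t a v} → m < n → n ≤ N →
              S n s t → Conv m s a → Red (suc m) a v → Slide n m v t
      slide m m<n n≤N p c ε = _ , _ , reverse c , inj₂ p , ε
      slide m m<n n≤N p c (s ◅ r) with splitBelow s
      ... | inj₁ s<m = slide m m<n n≤N p (c ◅◅ fwd s<m ◅ ε) r
      ... | inj₂ s≡m with diamond< m ≤-refl m<n n≤N p c s≡m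
      -- The `n`-step has vanished, and all that is left has labels below `n`.
      ...   | x , .x , d , inj₁ refl , e =
        Conv⇒Slide (weaken m<n (reverse (Red⇒Conv r)) ◅◅ weaken (<⇒≤ m<n) d ◅◅ e)
      ...   | x , y , d , inj₂ p′ , e = append (slide m m<n n≤N p′ (reverse d) r) e

    -- The same descent on `m` as in `diamond<`, now for two steps with the top label; it bottoms
    -- out in `peak≡`.
    diamond≡ : ∀ m {s t s₁ u} → m ≤ N → S N s t → Conv m s s₁ → S N s₁ u →
               ∃ λ v → Slide N N t v × Slide N N u v
    diamond≡ zero m≤N p c q with cr 0 z≤n c
    ... | _ , ε , ε = peak≡ 0<N p q
    ... | _ , (_ , () , _) ◅ _ , _
    ... | _ , ε , (_ , () , _) ◅ _
    diamond≡ (suc m) m<N p c q with cr (suc m) m<N c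
    ... | v , r₁ , r₂
      with slide m m<N ≤-refl p ε r₁ | slide m m<N ≤-refl q ε r₂
    ...   | x₁ , y₁ , d₁ , inj₁ refl , e₁ | x₂ , y₂ , d₂ , o , e₂ =
      _ , (x₂ , y₂ , reverse e₁ ◅◅ weaken (<⇒≤ m<N) (reverse d₁ ◅◅ d₂) , o , e₂) ,
      Conv⇒Slide ε
    ...   | x₁ , y₁ , d₁ , inj₂ p′ , e₁ | x₂ , y₂ , d₂ , inj₁ refl , e₂ =
      _ , Conv⇒Slide ε ,
      (x₁ , y₁ , reverse e₂ ◅◅ weaken (<⇒≤ m<N) (reverse d₂ ◅◅ d₁) , inj₂ p′ , e₁)
    ...   | x₁ , y₁ , d₁ , inj₂ p′ , e₁ | x₂ , y₂ , d₂ , inj₂ q′ , e₂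
      with diamond≡ m (<⇒≤ m<N) p′ (reverse d₁ ◅◅ d₂) q′
    ...     | w , f , g = w , prepend (reverse e₁) f , prepend (reverse e₂) g

    slide-diamond : ∀ {s t u} → Slide N N s t → Slide N N s u →
                    ∃ λ v → Slide N N t v × Slide N N u v
    slide-diamond (x₁ , y₁ , d₁ , inj₁ refl , e₁) (x₂ , y₂ , d₂ , o , e₂) =
      _ , (x₂ , y₂ , reverse e₁ ◅◅ reverse d₁ ◅◅ d₂ , o , e₂) , Conv⇒Slide ε
    slide-diamond (x₁ , y₁ , d₁ , inj₂ p , e₁) (x₂ , y₂ , d₂ , inj₁ refl , e₂) =
      _ , Conv⇒Slide ε , (x₁ , y₁ , reverse e₂ ◅◅ reverse d₂ ◅◅ d₁ , inj₂ p , e₁)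
    slide-diamond (x₁ , y₁ , d₁ , inj₂ p , e₁) (x₂ , y₂ , d₂ , inj₂ q , e₂)
      with diamond≡ N ≤-refl p (reverse d₁ ◅◅ d₂) q
    ... | w , f , g = w , prepend (reverse e₁) f , prepend (reverse e₂) g

    strip : ∀ {s t u} → Slide N N s t → Star (Slide N N) s u →
            ∃ λ v → Star (Slide N N) t v × Slide N N u v
    strip p ε = _ , ε , p
    strip p (q ◅ qs) with slide-diamond p q
    ... | _ , q′ , p′ with strip p′ qs
    ...   | v , qs′ , p″ = v , q′ ◅ qs′ , p″

    Below⇒Slide : ∀ {a b} → Below (suc N) a b → Slide N N a b
    Below⇒Slide s with splitBelow s
    ... | inj₁ s<N = Conv⇒Slide (fwd s<N ◅ ε)
    ... | inj₂ s≡N = _ , _ , ε , inj₂ s≡N , ε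

    slide-joinable : ∀ {a b} → Conv (suc N) a b →
                     ∃ λ c → Star (Slide N N) a c × Star (Slide N N) b c
    slide-joinable ε = _ , ε , ε
    slide-joinable (fwd s ◅ c) with slide-joinable c
    ... | d , p , q = d , Below⇒Slide s ◅ p , q
    slide-joinable (bwd s ◅ c) with slide-joinable c
    ... | d , p , q with strip (Below⇒Slide s) p
    ...   | v , p′ , q′ = v , p′ , q ◅◅ q′ ◅ ε

    -- Once `a` and `b` are joined at `v`, the `N`-step slides along the reduction from `b` to `v`.
    -- Only a conversion with a smaller bound then separates it from `v`, and recursion on `m`
    -- removes that gap.
    follow : ∀ m {a b c} → m ≤ N → Conv m a b → S N b c →
             ∃ λ d → Red (suc N) a d × Conv N d c
    follow zero m≤N c p with cr 0 z≤n c
    ... | _ , ε , ε = _ , (N , ≤-refl , p) ◅ ε , ε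
    ... | _ , (_ , () , _) ◅ _ , _
    ... | _ , ε , (_ , () , _) ◅ _
    follow (suc m) m<N c p with cr (suc m) m<N c
    ... | v , r₁ , r₂ with slide m m<N ≤-refl p ε r₂
    ...   | x , y , d , inj₁ refl , e =
      v , weakenRed (m≤n⇒m≤1+n m<N) r₁ , weaken (<⇒≤ m<N) d ◅◅ e
    ...   | x , y , d , inj₂ p′ , e with follow m (<⇒≤ m<N) d p′
    ...     | w , r , f = w , weakenRed (m≤n⇒m≤1+n m<N) r₁ ◅◅ r , f ◅◅ e

    -- The reduction simulates the slides one by one, lagging behind by a conversion below `N`.
    slides⇒Red : ∀ {a b c} → Conv N a b → Star (Slide N N) b c →
                 ∃ λ d → Red (suc N) a d × Conv N d c
    slides⇒Red c ε = _ , ε , c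
    slides⇒Red c ((x , .x , d , inj₁ refl , e) ◅ ps) = slides⇒Red (c ◅◅ d ◅◅ e) ps
    slides⇒Red c ((x , y , d , inj₂ p , e) ◅ ps) with follow N ≤-refl (c ◅◅ d) p
    ... | w , r , f with slides⇒Red (f ◅◅ e) ps
    ...   | z , r′ , g = z , r ◅◅ r′ , g

    next : ChurchRosser (suc N)
    next c with slide-joinable c
    ... | _ , p , q with slides⇒Red ε p | slides⇒Red ε q
    -- Both simulating reductions end in terms convertible below `N`, where `cr` applies.
    ...   | _ , r₁ , d₁ | _ , r₂ , d₂ with cr N ≤-refl (d₁ ◅◅ reverse d₂)
    ...     | z , r₁′ , r₂′ =
      z , r₁ ◅◅ weakenRed (n≤1+n N) r₁′ , r₂ ◅◅ weakenRed (n≤1+n N) r₂′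

  -- The bound `N` makes the strong induction on `k` structural.
  churchRosser≤ : ∀ N k → k ≤ N → ChurchRosser k
  churchRosser≤ _ zero _ ε = _ , ε , ε
  churchRosser≤ _ zero _ (fwd (_ , () , _) ◅ _)
  churchRosser≤ _ zero _ (bwd (_ , () , _) ◅ _)
  churchRosser≤ _ (suc zero) _ = base
  churchRosser≤ (suc N) (suc (suc k)) (s≤s k<N) =
    Level.next (suc k) (s≤s z≤n) λ j j≤k → churchRosser≤ N j (≤-trans j≤k k<N)

  churchRosser : ∀ k → ChurchRosser k
  churchRosser k = churchRosser≤ k k ≤-refl

-- Terms

m+n≤1⇒n≡0 : ∀ m {n} → 0 < m → m + n ≤ 1 → n ≡ 0
m+n≤1⇒n≡0 (suc m) _ (s≤s le) = m+n≡0⇒n≡0 m (n≤0⇒n≡0 le)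

0<m+n⇒0<m⊎0<n : ∀ m {n} → 0 < m + n → 0 < m ⊎ 0 < n
0<m+n⇒0<m⊎0<n zero    0<n = inj₂ 0<n
0<m+n⇒0<m⊎0<n (suc m) _   = inj₁ (s≤s z≤n)

module Terms (Sig : Signature) where
  open Signature Sig
  open Rewriting Sig

  ≡ᵇ-refl : ∀ x → (x ≡ᵇ x) ≡ true
  ≡ᵇ-refl zero    = refl
  ≡ᵇ-refl (suc x) = ≡ᵇ-refl x

  ≢⇒≡ᵇ-false : ∀ {x y} → x ≢ y → (x ≡ᵇ y) ≡ false
  ≢⇒≡ᵇ-false {zero}  {zero}  x≢y = contradiction refl x≢y
  ≢⇒≡ᵇ-false {zero}  {suc y} x≢y = refl
  ≢⇒≡ᵇ-false {suc x} {zero}  x≢y = refl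
  ≢⇒≡ᵇ-false {suc x} {suc y} x≢y = ≢⇒≡ᵇ-false (x≢y ∘ cong suc)

  count-var-self : ∀ x → count x (var x) ≡ 1
  count-var-self x rewrite ≡ᵇ-refl x = refl

  count-var-other : ∀ {x y} → x ≢ y → count x (var y) ≡ 0
  count-var-other x≢y rewrite ≢⇒≡ᵇ-false x≢y = refl

  update : Subst → Var → Term → Subst
  update σ x u y = if x ≡ᵇ y then u else σ y

  update-self : ∀ σ x u → update σ x u x ≡ u
  update-self σ x u rewrite ≡ᵇ-refl x = refl

  update-other : ∀ σ {x} u {y} → x ≢ y → update σ x u y ≡ σ y
  update-other σ u x≢y rewrite ≢⇒≡ᵇ-false x≢y = refl

  mutual
    subst-cong : ∀ t {σ τ} → (∀ x → 0 < count x t → σ x ≡ τ x) → t ⟨ σ ⟩ ≡ t ⟨ τ ⟩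
    subst-cong (var x)    σ≗τ = σ≗τ x (≤-reflexive (sym (count-var-self x)))
    subst-cong (fun f ts) σ≗τ = cong (fun f) (subst-cong* ts σ≗τ)

    subst-cong* : ∀ {n} (ts : Vec Term n) {σ τ} →
                  (∀ x → 0 < count* x ts → σ x ≡ τ x) → ts ⟨ σ ⟩* ≡ ts ⟨ τ ⟩*
    subst-cong* []       σ≗τ = refl
    subst-cong* (t ∷ ts) σ≗τ =
      cong₂ _∷_ (subst-cong t λ x 0<n → σ≗τ x (m≤n⇒m≤n+o _ 0<n))
                (subst-cong* ts λ x 0<n → σ≗τ x (m≤n⇒m≤o+n (count x t) 0<n))

  mutual
    subst-∘ : ∀ t σ τ → t ⟨ σ ⟩ ⟨ τ ⟩ ≡ t ⟨ (λ x → σ x ⟨ τ ⟩) ⟩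
    subst-∘ (var x)    σ τ = refl
    subst-∘ (fun f ts) σ τ = cong (fun f) (subst-∘* ts σ τ)

    subst-∘* : ∀ {n} (ts : Vec Term n) σ τ → ts ⟨ σ ⟩* ⟨ τ ⟩* ≡ ts ⟨ (λ x → σ x ⟨ τ ⟩) ⟩*
    subst-∘* []       σ τ = refl
    subst-∘* (t ∷ ts) σ τ = cong₂ _∷_ (subst-∘ t σ τ) (subst-∘* ts σ τ)

  mutual
    subst-var : ∀ t → t ⟨ var ⟩ ≡ t
    subst-var (var x)    = refl
    subst-var (fun f ts) = cong (fun f) (subst-var* ts)

    subst-var* : ∀ {n} (ts : Vec Term n) → ts ⟨ var ⟩* ≡ ts
    subst-var* []       = refl
    subst-var* (t ∷ ts) = cong₂ _∷_ (subst-var t) (subst-var* ts)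

  0<count⇒≢ : ∀ {x y} t → count x t ≡ 0 → 0 < count y t → x ≢ y
  0<count⇒≢ t x∉t y∈t refl = contradiction x∉t (m<n⇒n≢0 y∈t)

  update-fresh : ∀ t σ {x} u → count x t ≡ 0 → t ⟨ update σ x u ⟩ ≡ t ⟨ σ ⟩
  update-fresh t σ u x∉t = subst-cong t λ y y∈t → update-other σ u (0<count⇒≢ t x∉t y∈t)

  update-fresh* : ∀ {n} (ts : Vec Term n) σ {x} u → count* x ts ≡ 0 →
                  ts ⟨ update σ x u ⟩* ≡ ts ⟨ σ ⟩*
  update-fresh* ts σ {x} u x∉ts = subst-cong* ts λ y y∈ts →
    update-other σ {x} u λ { refl → contradiction x∉ts (m<n⇒n≢0 y∈ts) }

  mutual
    at-subst : ∀ s p {t} δ → s at p ≡ just t → (s ⟨ δ ⟩) at p ≡ just (t ⟨ δ ⟩)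
    at-subst s          []      δ refl = refl
    at-subst (fun f ts) (i ∷ p) δ eq   = atVec-subst ts i p δ eq

    atVec-subst : ∀ {n} (ts : Vec Term n) i p {t} δ →
                  atVec ts i p ≡ just t → atVec (ts ⟨ δ ⟩*) i p ≡ just (t ⟨ δ ⟩)
    atVec-subst (t ∷ ts) zero    p δ eq = at-subst t p δ eq
    atVec-subst (t ∷ ts) (suc i) p δ eq = atVec-subst ts i p δ eq

  mutual
    replace-subst : ∀ s p {t} u δ → s at p ≡ just t →
                    replace s p u ⟨ δ ⟩ ≡ replace (s ⟨ δ ⟩) p (u ⟨ δ ⟩)
    replace-subst s          []      u δ eq = refl
    replace-subst (fun f ts) (i ∷ p) u δ eq = cong (fun f) (replaceVec-subst ts i p u δ eq)

    replaceVec-subst : ∀ {n} (ts : Vec Term n) i p {t} u δ → atVec ts i p ≡ just t →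
                       replaceVec ts i p u ⟨ δ ⟩* ≡ replaceVec (ts ⟨ δ ⟩*) i p (u ⟨ δ ⟩)
    replaceVec-subst (t ∷ ts) zero    p u δ eq = cong (_∷ _) (replace-subst t p u δ eq)
    replaceVec-subst (t ∷ ts) (suc i) p u δ eq = cong (_ ∷_) (replaceVec-subst ts i p u δ eq)

  mutual
    count-at : ∀ x s p {t} → s at p ≡ just t → count x t ≤ count x s
    count-at x s          []      refl = ≤-refl
    count-at x (fun f ts) (i ∷ p) eq   = count-atVec x ts i p eq

    count-atVec : ∀ {n} x (ts : Vec Term n) i p {t} → atVec ts i p ≡ just t → count x t ≤ count* x ts
    count-atVec x (t ∷ ts) zero    p eq = m≤n⇒m≤n+o _ (count-at x t p eq)
    count-atVec x (t ∷ ts) (suc i) p eq = m≤n⇒m≤o+n (count x t) (count-atVec x ts i p eq)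

  -- Factors a position through one argument, so that `replaceVec ts i []` acts as a one-hole
  -- context.
  atVec-split : ∀ {n} (ts : Vec Term n) i p {w} → atVec ts i p ≡ just w →
                ∃ λ t → atVec ts i [] ≡ just t × t at p ≡ just w ×
                        (∀ y → replaceVec ts i p y ≡ replaceVec ts i [] (replace t p y))
  atVec-split (t ∷ ts) zero    p eq = t , refl , eq , λ y → refl
  atVec-split (t ∷ ts) (suc i) p eq with atVec-split ts i p eq
  ... | u , at-i , at-p , repl = u , at-i , at-p , λ y → cong (t ∷_) (repl y)

  atVec-hole : ∀ {n} (ts : Vec Term n) i {t} y q → atVec ts i [] ≡ just t →
               atVec (replaceVec ts i [] y) i q ≡ y at q
  atVec-hole (t ∷ ts) zero    y q eq = refl
  atVec-hole (t ∷ ts) (suc i) y q eq = atVec-hole ts i y q eq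

  replaceVec-hole : ∀ {n} (ts : Vec Term n) i y q z →
                    replaceVec (replaceVec ts i [] y) i q z ≡ replaceVec ts i [] (replace y q z)
  replaceVec-hole []       i       y q z = refl
  replaceVec-hole (t ∷ ts) zero    y q z = refl
  replaceVec-hole (t ∷ ts) (suc i) y q z = cong (t ∷_) (replaceVec-hole ts i y q z)

  replaceVec-self : ∀ {n} (ts : Vec Term n) i {t} → atVec ts i [] ≡ just t →
                    replaceVec ts i [] t ≡ ts
  replaceVec-self (t ∷ ts) zero    refl = refl
  replaceVec-self (t ∷ ts) (suc i) eq   = cong (t ∷_) (replaceVec-self ts i eq)

  atVec-parallel : ∀ {n} (ts : Vec Term n) {i j} p q y → i ≢ j →
                   atVec (replaceVec ts i p y) j q ≡ atVec ts j q
  atVec-parallel []       p q y i≢j = refl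
  atVec-parallel (t ∷ ts) {zero}  {zero}  p q y i≢j = contradiction refl i≢j
  atVec-parallel (t ∷ ts) {zero}  {suc j} p q y i≢j = refl
  atVec-parallel (t ∷ ts) {suc i} {zero}  p q y i≢j = refl
  atVec-parallel (t ∷ ts) {suc i} {suc j} p q y i≢j = atVec-parallel ts p q y (i≢j ∘ cong suc)

  replaceVec-comm : ∀ {n} (ts : Vec Term n) {i j} p q y z → i ≢ j →
                    replaceVec (replaceVec ts i p y) j q z ≡ replaceVec (replaceVec ts j q z) i p y
  replaceVec-comm []       p q y z i≢j = refl
  replaceVec-comm (t ∷ ts) {zero}  {zero}  p q y z i≢j = contradiction refl i≢j
  replaceVec-comm (t ∷ ts) {zero}  {suc j} p q y z i≢j = refl
  replaceVec-comm (t ∷ ts) {suc i} {zero}  p q y z i≢j = refl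
  replaceVec-comm (t ∷ ts) {suc i} {suc j} p q y z i≢j =
    cong (t ∷_) (replaceVec-comm ts p q y z (i≢j ∘ cong suc))

  -- Position p of t⟨σ⟩ lies at position q below an occurrence of the variable x of t.
  Through : Var → Term → Subst → Pos → Term → Set
  Through x t σ p w = ∃ λ q → 0 < count x t × σ x at q ≡ just w ×
    (count x t ≤ 1 → ∀ y → replace (t ⟨ σ ⟩) p y ≡ t ⟨ update σ x (replace (σ x) q y) ⟩)

  mutual
    -- The alternatives are critical and variable overlap. A variable position of `t` itself counts
    -- as `Through`, with `q` empty.
    locate : ∀ t σ p {w} → (t ⟨ σ ⟩) at p ≡ just w →
             (∃ λ u → IsFun u × t at p ≡ just u) ⊎ (∃ λ x → Through x t σ p w)
    locate (var x) σ p eq =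
      inj₂ (x , p , ≤-reflexive (sym (count-var-self x)) , eq ,
            λ _ y → sym (update-self σ x _))
    locate (fun f ts) σ []      eq = inj₁ (fun f ts , (f , ts , refl) , refl)
    locate (fun f ts) σ (i ∷ p) eq with locateVec ts σ i p eq
    ... | inj₁ found = inj₁ found
    ... | inj₂ (x , q , x∈ts , at-q , repl) =
      inj₂ (x , q , x∈ts , at-q , λ lin y → cong (fun f) (repl lin y))

    locateVec : ∀ {n} (ts : Vec Term n) σ i p {w} → atVec (ts ⟨ σ ⟩*) i p ≡ just w →
      (∃ λ u → IsFun u × atVec ts i p ≡ just u) ⊎
      (∃₂ λ x q → 0 < count* x ts × σ x at q ≡ just w ×
        (count* x ts ≤ 1 → ∀ y →
         replaceVec (ts ⟨ σ ⟩*) i p y ≡ ts ⟨ update σ x (replace (σ x) q y) ⟩*))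
    locateVec (t ∷ ts) σ zero p eq with locate t σ p eq
    ... | inj₁ found = inj₁ found
    ... | inj₂ (x , q , x∈t , at-q , repl) =
      inj₂ (x , q , m≤n⇒m≤n+o _ x∈t , at-q , λ lin y →
        cong₂ _∷_ (repl (m+n≤o⇒m≤o _ lin) y)
                  (sym (update-fresh* ts σ _ (m+n≤1⇒n≡0 (count x t) x∈t lin))))
    locateVec (t ∷ ts) σ (suc i) p eq with locateVec ts σ i p eq
    ... | inj₁ found = inj₁ found
    ... | inj₂ (x , q , x∈ts , at-q , repl) =
      inj₂ (x , q , m≤n⇒m≤o+n (count x t) x∈ts , at-q , λ lin y →
        -- `x` occurs in `ts`, so linearity keeps it out of `t`, which the update leaves alone.
        cong₂ _∷_ (sym (update-fresh t σ _
                     (m+n≤1⇒n≡0 (count* x ts) x∈ts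
                       (≤-trans (≤-reflexive (+-comm (count* x ts) (count x t))) lin))))
                  (repl (m+n≤o⇒n≤o (count x t) lin) y))

  mutual
    bound : Term → ℕ
    bound (var x)    = suc x
    bound (fun f ts) = bound* ts

    bound* : ∀ {n} → Vec Term n → ℕ
    bound* []       = 0
    bound* (t ∷ ts) = bound t ⊔ bound* ts

  mutual
    count⇒<bound : ∀ x t → 0 < count x t → x < bound t
    count⇒<bound x (var y) x∈t with x ≟ y
    ... | yes refl = ≤-refl
    ... | no  x≢y  = contradiction (count-var-other x≢y) (m<n⇒n≢0 x∈t)
    count⇒<bound x (fun f ts) x∈ts = count*⇒<bound* x ts x∈ts

    count*⇒<bound* : ∀ {n} x (ts : Vec Term n) → 0 < count* x ts → x < bound* ts
    count*⇒<bound* x (t ∷ ts) x∈ with 0<m+n⇒0<m⊎0<n (count x t) x∈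
    ... | inj₁ x∈t  = ≤-trans (count⇒<bound x t x∈t) (m≤m⊔n _ _)
    ... | inj₂ x∈ts = ≤-trans (count*⇒<bound* x ts x∈ts) (m≤n⊔m (bound t) _)

  -- A duplicated variable occurs in the right-hand side, so a search below its `bound` is
  -- exhaustive.
  duplicating? : ∀ ρ → Dec (Duplicating ρ)
  duplicating? ρ =
    Dec.map′ (λ (x , _ , dup) → x , dup)
             (λ (x , dup) → x , count⇒<bound x (rhs ρ) (≤-<-trans z≤n dup) , dup)
             (anyUpTo? (λ x → count x (lhs ρ) <? count x (rhs ρ)) (bound (rhs ρ)))

  -- Linear unification

  -- An arbitrary condition in place of a single equation lets equations be added one at a time.
  MostGeneral : (Subst → Set) → Subst → Set
  MostGeneral P μ = P μ × (∀ ν → P ν → ∃ λ δ → ∀ x → ν x ≡ μ x ⟨ δ ⟩)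

  MostGeneral-map : ∀ {P Q : Subst → Set} → (∀ {ν} → P ν → Q ν) → (∀ {ν} → Q ν → P ν) →
                    ∃ (MostGeneral P) → ∃ (MostGeneral Q)
  MostGeneral-map P⇒Q Q⇒P (μ , Pμ , general) = μ , P⇒Q Pμ , λ ν Qν → general ν (Q⇒P Qν)

  -- As `P` ignores `x` and `b` lacks it, `μ` may be overwritten at `x` by `b ⟨ μ ⟩`. The `δ`
  -- factoring a solution `ν` through `μ` still works: at `x`, both sides equal `b ⟨ ν ⟩`.
  bind : ∀ (P : Subst → Set) x b → count x b ≡ 0 →
         (∀ {ν ν′} → (∀ y → x ≢ y → ν y ≡ ν′ y) → P ν → P ν′) →
         ∃ (MostGeneral P) → ∃ (MostGeneral (λ ν → P ν × ν x ≡ b ⟨ ν ⟩))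
  bind P x b x∉b invariant (μ , Pμ , general) = μ′ , (Pμ′ , unifies) , general′
    where
    μ′ : Subst
    μ′ = update μ x (b ⟨ μ ⟩)
    Pμ′ : P μ′
    Pμ′ = invariant (λ y x≢y → sym (update-other μ (b ⟨ μ ⟩) x≢y)) Pμ
    unifies : μ′ x ≡ b ⟨ μ′ ⟩
    unifies = trans (update-self μ x _) (sym (update-fresh b μ _ x∉b))
    general′ : ∀ ν → P ν × ν x ≡ b ⟨ ν ⟩ → ∃ λ δ → ∀ y → ν y ≡ μ′ y ⟨ δ ⟩
    general′ ν (Pν , νx≡) with general ν Pν
    ... | δ , ν≗ = δ , at-var
      where
      at-var : ∀ y → ν y ≡ μ′ y ⟨ δ ⟩
      at-var y with x ≟ y
      ... | no x≢y = trans (ν≗ y) (cong _⟨ δ ⟩ (sym (update-other μ (b ⟨ μ ⟩) x≢y)))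
      ... | yes refl = trans νx≡ (trans (subst-cong b λ z _ → ν≗ z)
                         (trans (sym (subst-∘ b μ δ)) (cong _⟨ δ ⟩ (sym (update-self μ x _)))))

  fun-injectiveˡ : ∀ {f g as bs} → fun f as ≡ fun g bs → f ≡ g
  fun-injectiveˡ refl = refl

  fun-injectiveʳ : ∀ {f as bs} → fun f as ≡ fun f bs → as ≡ bs
  fun-injectiveʳ refl = refl

  -- P stands for the equations solved already.  By linearity they share no variable with
  -- a and b, hence solutions need not be propagated and there is no occurs check.
  mutual
    unify : ∀ (P : Subst → Set) a b {ν₀} → a ⟨ ν₀ ⟩ ≡ b ⟨ ν₀ ⟩ →
            (∀ x → count x a + count x b ≤ 1) →
            (∀ {ν ν′} → (∀ x → count x a + count x b ≡ 0 → ν x ≡ ν′ x) → P ν → P ν′) →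
            ∃ (MostGeneral P) → ∃ (MostGeneral (λ ν → P ν × a ⟨ ν ⟩ ≡ b ⟨ ν ⟩))
    unify P (var x) b eq linear invariant =
      bind P x b (m+n≤1⇒n≡0 (count x (var x)) (≤-reflexive (sym (count-var-self x))) (linear x))
        λ agree → invariant λ y y∉ → agree y λ { refl →
          contradiction (trans (sym (count-var-self x)) (m+n≡0⇒m≡0 _ y∉)) λ () }
    unify P a@(fun _ _) (var x) eq linear invariant m =
      MostGeneral-map (λ (Pν , e) → Pν , sym e) (λ (Pν , e) → Pν , sym e)
        (bind P x a
          (m+n≤1⇒n≡0 (count x (var x)) (≤-reflexive (sym (count-var-self x)))
            (≤-trans (≤-reflexive (+-comm (count x (var x)) (count x a))) (linear x)))
          (λ agree → invariant λ y y∉ → agree y λ { refl →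
            contradiction (trans (sym (count-var-self x)) (m+n≡0⇒n≡0 (count x a) y∉)) λ () })
          m)
    -- The given unifier `ν₀` excludes a clash of head symbols.
    unify P (fun f as) (fun g bs) eq linear invariant m with fun-injectiveˡ eq
    ... | refl =
      MostGeneral-map (λ (Pν , e) → Pν , cong (fun f) e) (λ (Pν , e) → Pν , fun-injectiveʳ e)
        (unifyVec P as bs (fun-injectiveʳ eq) linear invariant m)

    unifyVec : ∀ {n} (P : Subst → Set) (as bs : Vec Term n) {ν₀} → as ⟨ ν₀ ⟩* ≡ bs ⟨ ν₀ ⟩* →
      (∀ x → count* x as + count* x bs ≤ 1) →
      (∀ {ν ν′} → (∀ x → count* x as + count* x bs ≡ 0 → ν x ≡ ν′ x) → P ν → P ν′) →
      ∃ (MostGeneral P) → ∃ (MostGeneral (λ ν → P ν × as ⟨ ν ⟩* ≡ bs ⟨ ν ⟩*))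
    unifyVec P [] [] eq linear invariant m = MostGeneral-map (λ Pν → Pν , refl) proj₁ m
    unifyVec P (a ∷ as) (b ∷ bs) eq linear invariant m =
      MostGeneral-map (λ ((Pν , e) , es) → Pν , cong₂ _∷_ e es)
                      (λ (Pν , es) → (Pν , ∷-injectiveˡ es) , ∷-injectiveʳ es)
        (unifyVec _ as bs (∷-injectiveʳ eq) linear-tail invariant-tail
          (unify P a b (∷-injectiveˡ eq) linear-head
            (λ agree → invariant λ x x∉ → agree x (proj₁ (all-zero x x∉))) m))
      where
      regroup : ∀ x → (count x a + count* x as) + (count x b + count* x bs) ≡
                      (count x a + count x b) + (count* x as + count* x bs)
      regroup x = interchange +-commutativeSemigroup (count x a) (count* x as) (count x b) (count* x bs)
      linear′ : ∀ x → (count x a + count x b) + (count* x as + count* x bs) ≤ 1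
      linear′ x = ≤-trans (≤-reflexive (sym (regroup x))) (linear x)
      linear-head : ∀ x → count x a + count x b ≤ 1
      linear-head x = m+n≤o⇒m≤o _ (linear′ x)
      linear-tail : ∀ x → count* x as + count* x bs ≤ 1
      linear-tail x = m+n≤o⇒n≤o (count x a + count x b) (linear′ x)
      all-zero : ∀ x → (count x a + count* x as) + (count x b + count* x bs) ≡ 0 →
               count x a + count x b ≡ 0 × count* x as + count* x bs ≡ 0
      all-zero x e = m+n≡0⇒m≡0 _ e′ , m+n≡0⇒n≡0 (count x a + count x b) e′
        where
        e′ : (count x a + count x b) + (count* x as + count* x bs) ≡ 0
        e′ = trans (sym (regroup x)) e
      -- By linearity the variables of `a` and `b` do not occur in the tail, so the head equation
      -- survives any change at tail variables and may join `P`.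
      invariant-tail : ∀ {ν ν′} → (∀ x → count* x as + count* x bs ≡ 0 → ν x ≡ ν′ x) →
                       P ν × a ⟨ ν ⟩ ≡ b ⟨ ν ⟩ → P ν′ × a ⟨ ν′ ⟩ ≡ b ⟨ ν′ ⟩
      invariant-tail {ν} {ν′} agree (Pν , e) =
        invariant (λ x x∉ → agree x (proj₂ (all-zero x x∉))) Pν ,
        trans (sym (subst-cong a λ x x∈a → agree′ x (m≤n⇒m≤n+o _ x∈a)))
          (trans e (subst-cong b λ x x∈b → agree′ x (m≤n⇒m≤o+n (count x a) x∈b)))
        where
        agree′ : ∀ x → 0 < count x a + count x b → ν x ≡ ν′ x
        agree′ x x∈ = agree x (m+n≤1⇒n≡0 (count x a + count x b) x∈ (linear′ x))

  linear-mgu : ∀ a b {ν} → a ⟨ ν ⟩ ≡ b ⟨ ν ⟩ → (∀ x → count x a + count x b ≤ 1) →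
               ∃ λ μ → MGU μ a b
  linear-mgu a b eq linear
    -- The accumulation starts from a trivially true condition, whose most general solution is
    -- `var`.
    with unify (λ _ → 0 ≡ 0) a b eq linear (λ _ e → e)
           (var , refl , λ ν _ → ν , λ x → refl)
  ... | μ , (_ , e) , general = μ , e , λ ν eν → general ν (refl , eν)

  -- Renaming rules apart.

  module Swap (N : ℕ) where

    -- Exchanges the intervals from 0 to `N` and from `N` to `N + N`. A plain shift by `N` would not
    -- be onto, and `Variant` demands a bijection.
    swap : Var → Var
    swap x with x <? N | x <? N + N
    ... | yes _ | _     = x + N
    ... | no _  | yes _ = x ∸ N
    ... | no _  | no _  = x

    swap-< : ∀ {x} → x < N → swap x ≡ x + N
    swap-< {x} x<N with x <? N | x <? N + N
    ... | yes _  | _ = refl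
    ... | no x≮N | _ = contradiction x<N x≮N

    swap-≥ : ∀ {x} → x < N → swap (x + N) ≡ x
    swap-≥ {x} x<N with x + N <? N | x + N <? N + N
    ... | yes p | _     = contradiction p (≤⇒≯ (m≤n+m N x))
    ... | no _  | yes _ = m+n∸n≡m x N
    ... | no _  | no q  = contradiction (+-monoˡ-< N x<N) q

    swap-involutive : ∀ x → swap (swap x) ≡ x
    swap-involutive x with x <? N | x <? N + N in eq
    ... | yes x<N | _     = swap-≥ x<N
    ... | no x≮N  | yes p =
      trans (swap-< (+-cancelʳ-< N (x ∸ N) N (≤-trans (≤-reflexive (cong suc x∸N+N)) p))) x∸N+N
      where
      x∸N+N : x ∸ N + N ≡ x
      x∸N+N = m∸n+n≡m (≮⇒≥ x≮N)
    ... | no x≮N  | no _ with x <? N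
    ...   | yes p = contradiction p x≮N
    ...   | no _ rewrite eq = refl

    swap↔ : Var ↔ Var
    swap↔ = mk↔ₛ′ swap swap swap-involutive swap-involutive

    mutual
      count-swap : ∀ y t → count y (t ⟨ var ∘ swap ⟩) ≡ count (swap y) t
      count-swap y (var x) with y ≟ swap x
      ... | yes refl = trans (count-var-self (swap x))
                         (sym (trans (cong (λ z → count z (var x)) (swap-involutive x)) (count-var-self x)))
      ... | no y≢ = trans (count-var-other y≢)
                      (sym (count-var-other {swap y} {x} λ { refl → y≢ (sym (swap-involutive y)) }))
      count-swap y (fun f ts) = count*-swap y ts

      count*-swap : ∀ {n} y (ts : Vec Term n) → count* y (ts ⟨ var ∘ swap ⟩*) ≡ count* (swap y) ts
      count*-swap y []       = refl
      count*-swap y (t ∷ ts) = cong₂ _+_ (count-swap y t) (count*-swap y ts)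

-- Local peaks

module Peaks (Sig : Signature) (R : Rewriting.TRS Sig) where
  open Signature Sig
  open Rewriting Sig hiding (Conv)
  open Terms Sig

  step-subst : ∀ {ρ s t} δ → Step R ρ s t → Step R ρ (s ⟨ δ ⟩) (t ⟨ δ ⟩)
  step-subst {ρ} {s} δ (ρ∈R , p , σ , at-p , refl) =
    ρ∈R , p , (λ x → σ x ⟨ δ ⟩) ,
    trans (at-subst s p δ at-p) (cong just (subst-∘ (lhs ρ) σ δ)) ,
    trans (replace-subst s p _ δ at-p) (cong (replace (s ⟨ δ ⟩) p) (subst-∘ (rhs ρ) σ δ))

  step-hole : ∀ {ρ s t} f (ts : Vec Term (arity f)) j {u} → atVec ts j [] ≡ just u →
              Step R ρ s t →
              Step R ρ (fun f (replaceVec ts j [] s)) (fun f (replaceVec ts j [] t))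
  step-hole {s = s} f ts j at-j (ρ∈R , p , σ , at-p , refl) =
    ρ∈R , j ∷ p , σ , trans (atVec-hole ts j s p at-j) at-p ,
    cong (fun f) (sym (replaceVec-hole ts j s p _))

  StepVec : ∀ {n} → Rule → Vec Term n → Vec Term n → Set
  StepVec ρ ts us = R ρ × Σ ℕ λ j → Σ Pos λ p → Σ Subst λ σ →
    atVec ts j p ≡ just (lhs ρ ⟨ σ ⟩) × us ≡ replaceVec ts j p (rhs ρ ⟨ σ ⟩)

  step-here : ∀ {n ρ t u} {ts : Vec Term n} → Step R ρ t u → StepVec ρ (t ∷ ts) (u ∷ ts)
  step-here (ρ∈R , p , σ , at-p , refl) = ρ∈R , 0 , p , σ , at-p , refl

  step-there : ∀ {n ρ t} {ts us : Vec Term n} → StepVec ρ ts us → StepVec ρ (t ∷ ts) (t ∷ us)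
  step-there (ρ∈R , j , p , σ , at-p , refl) = ρ∈R , suc j , p , σ , at-p , refl

  step-fun : ∀ {ρ f ts us} → StepVec ρ ts us → Step R ρ (fun f ts) (fun f us)
  step-fun (ρ∈R , j , p , σ , at-p , refl) = ρ∈R , j ∷ p , σ , at-p , refl

  module _ {ρ : Rule} {σ : Subst} {x : Var} {u : Term} (step : Step R ρ (σ x) u) where

    mutual
      steps-update : ∀ t → Star (Step R ρ) (t ⟨ σ ⟩) (t ⟨ update σ x u ⟩)
      steps-update (var y) with x ≟ y
      ... | yes refl rewrite update-self σ x u = step ◅ ε
      ... | no x≢y rewrite update-other σ u x≢y = ε
      steps-update (fun f ts) = Star.gmap (fun f) step-fun (steps-update* ts)

      steps-update* : ∀ {n} (ts : Vec Term n) → Star (StepVec ρ) (ts ⟨ σ ⟩*) (ts ⟨ update σ x u ⟩*)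
      steps-update* []       = ε
      steps-update* (t ∷ ts) = Star.gmap (_∷ _) step-here (steps-update t) ◅◅
                               Star.gmap (_ ∷_) step-there (steps-update* ts)

    mutual
      step-update : ∀ t → count x t ≤ 1 →
                    t ⟨ σ ⟩ ≡ t ⟨ update σ x u ⟩ ⊎ Step R ρ (t ⟨ σ ⟩) (t ⟨ update σ x u ⟩)
      step-update (var y) _ with x ≟ y
      ... | yes refl rewrite update-self σ x u = inj₂ step
      ... | no x≢y = inj₁ (sym (update-other σ u x≢y))
      step-update (fun f ts) lin with step-update* ts lin
      ... | inj₁ eq = inj₁ (cong (fun f) eq)
      ... | inj₂ st = inj₂ (step-fun st)

      step-update* : ∀ {n} (ts : Vec Term n) → count* x ts ≤ 1 →
        ts ⟨ σ ⟩* ≡ ts ⟨ update σ x u ⟩* ⊎ StepVec ρ (ts ⟨ σ ⟩*) (ts ⟨ update σ x u ⟩*)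
      step-update* [] _ = inj₁ refl
      step-update* (t ∷ ts) lin with count x t in eq
      ... | zero rewrite update-fresh t σ u eq with step-update* ts lin
      ...   | inj₁ eqs = inj₁ (cong (_ ∷_) eqs)
      ...   | inj₂ st  = inj₂ (step-there st)
      step-update* (t ∷ ts) lin | suc n
        rewrite update-fresh* ts σ u (m+n≤1⇒n≡0 (suc n) (s≤s z≤n) lin)
        with step-update t (≤-trans (≤-reflexive eq) (m+n≤o⇒m≤o (suc n) lin))
      ...   | inj₁ eqs = inj₁ (cong (_∷ _) eqs)
      ...   | inj₂ st  = inj₂ (step-here st)

  module _ (i : Rule → ℕ) where

    -- The successor keeps label 0 free for steps from small terms. The source `a` of the peak is
    -- recorded because reachability from it is what the fan property supplies.
    data Reached (a : Term) : ℕ → Term → Term → Set where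
      reached : ∀ {ρ x y} → R ⊢ a ⟶* x → Step R ρ x y → Reached a (suc (i ρ)) x y

    -- In the `dup` cases one side may need many steps. They become harmless only once their source
    -- is known to be small, so no labels are assigned yet.
    data Peak (ρ₁ ρ₂ : Rule) (a b c : Term) : Set where
      fan  : Labelled.Diagram (Reached a) (suc (i ρ₁)) (suc (i ρ₂)) b c → Peak ρ₁ ρ₂ a b c
      dup₁ : ∀ {d} → Duplicating ρ₁ → Step R ρ₁ c d → R ⊢ b ⟶* d → Peak ρ₁ ρ₂ a b c
      dup₂ : ∀ {d} → Duplicating ρ₂ → Step R ρ₂ b d → R ⊢ c ⟶* d → Peak ρ₁ ρ₂ a b c

    flip-Peak : ∀ {ρ₁ ρ₂ a b c} → Peak ρ₁ ρ₂ a b c → Peak ρ₂ ρ₁ a c b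
    flip-Peak {a = a} (fan d) = fan (Labelled.flip-Diagram (Reached a) d)
    flip-Peak (dup₁ dup s r) = dup₂ dup s r
    flip-Peak (dup₂ dup s r) = dup₁ dup s r

    module _ (F : Term → Term) (F-step : ∀ {ρ s t} → Step R ρ s t → Step R ρ (F s) (F t)) where

      map-⟶* : ∀ {s t} → R ⊢ s ⟶* t → R ⊢ F s ⟶* F t
      map-⟶* = Star.gmap F λ (ρ , st) → ρ , F-step st

      map-Reached : ∀ {a n x y} → Reached a n x y → Reached (F a) n (F x) (F y)
      map-Reached (reached r st) = reached (map-⟶* r) (F-step st)

      map-Peak : ∀ {ρ₁ ρ₂ a b c} → Peak ρ₁ ρ₂ a b c → Peak ρ₁ ρ₂ (F a) (F b) (F c)
      map-Peak (fan d)        = fan (map-Diagram F map-Reached d)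
      map-Peak (dup₁ dup s r) = dup₁ dup (F-step s) (map-⟶* r)
      map-Peak (dup₂ dup s r) = dup₂ dup (F-step s) (map-⟶* r)

    module _ {a : Term} where
      open Labelled (Reached a)
      open Rewriting Sig using () renaming (Conv to FanConv)

      fan-source : ∀ {P x y} → FanConv R i P (R ⊢ a ⟶*_) x y → R ⊢ a ⟶* x
      fan-source (ε r)           = r
      fan-source (fwd _ _ _ r _) = r
      fan-source (bwd _ _ _ r _) = r

      fan-target : ∀ {P x y} → FanConv R i P (R ⊢ a ⟶*_) x y → R ⊢ a ⟶* y
      fan-target (ε r)           = r
      fan-target (fwd _ _ _ _ c) = fan-target c
      fan-target (bwd _ _ _ _ c) = fan-target c

      fromFanConv : ∀ {P k x y} → (∀ {n} → P n → suc n < k) →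
                    FanConv R i P (R ⊢ a ⟶*_) x y → Conv k x y
      fromFanConv P⇒< (ε _)            = ε
      fromFanConv P⇒< (fwd ρ st p r c) = fwd (_ , P⇒< p , reached r st) ◅ fromFanConv P⇒< c
      -- A backward step starts at the next term of the conversion, whose reachability is stored in
      -- `c`.
      fromFanConv P⇒< (bwd ρ st p r c) =
        bwd (_ , P⇒< p , reached (fan-source c) st) ◅ fromFanConv P⇒< c

      fromOptStep : ∀ {k x y} → R ⊢ a ⟶* x → OptStep R i (_≤ k) x y →
                    x ≡ y ⊎ Below (suc (suc k)) x y
      fromOptStep r (inj₁ eq)           = inj₁ eq
      -- One successor comes from the shifted label, the other from turning at most into below.
      fromOptStep r (inj₂ (ρ , st , p)) = inj₂ (_ , s≤s (s≤s p) , reached r st)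

      fromFanDiagram : ∀ {t u α β} → DecreasingFanDiagram R i a t u α β →
                       Diagram (suc α) (suc β) t u
      fromFanDiagram {α = α} {β} (t′ , t″ , u″ , u′ , c₁ , o₁ , c₂ , o₂ , c₃) =
        t′ , t″ , u″ , u′ , fromFanConv s≤s c₁ , fromOptStep (fan-target c₁) o₁ ,
        fromFanConv [ (λ n<α → s≤s (m≤n⇒m≤n⊔o β n<α)) , (λ n<β → s≤s (m≤n⇒m≤o⊔n α n<β)) ] c₂ ,
        fromOptStep (fan-source c₃) o₂ , fromFanConv s≤s c₃

      -- Each closing step uses the rule of the opposite step, hence has exactly the label that the
      -- optional step of a diagram permits.
      valley : ∀ {ρ₁ ρ₂ b c d} → R ⊢ a ⟶ b → R ⊢ a ⟶ c →
               b ≡ d ⊎ Step R ρ₂ b d → c ≡ d ⊎ Step R ρ₁ c d → Peak ρ₁ ρ₂ a b c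
      valley {d = d} a⟶b a⟶c o₁ o₂ = fan (_ , d , d , _ , ε , opt a⟶b o₁ , ε , opt a⟶c o₂ , ε)
        where
        opt : ∀ {ρ x y} → R ⊢ a ⟶ x → x ≡ y ⊎ Step R ρ x y → x ≡ y ⊎ Below (suc (suc (i ρ))) x y
        opt a⟶x (inj₁ eq) = inj₁ eq
        opt a⟶x (inj₂ st) = inj₂ (_ , ≤-refl , reached (a⟶x ◅ ε) st)

    module _ (leftLinear : LeftLinear R) (critical : CriticalPeaksDecreasingFan R i) where

      -- Renaming `ρ₁` apart merges `σ₁` and `σ₂` into one unifier `ν`. It factors as `μ` followed
      -- by `δ` for a most general `μ`, so the peak is the `δ`-instance of a critical peak, and so
      -- is its diagram.
      criticalPeak : ∀ {ρ₁ ρ₂ σ₁ σ₂ p u} → R ρ₁ → R ρ₂ → IsFun u → lhs ρ₂ at p ≡ just u →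
        u ⟨ σ₂ ⟩ ≡ lhs ρ₁ ⟨ σ₁ ⟩ →
        Peak ρ₁ ρ₂ (lhs ρ₂ ⟨ σ₂ ⟩) (replace (lhs ρ₂ ⟨ σ₂ ⟩) p (rhs ρ₁ ⟨ σ₁ ⟩)) (rhs ρ₂ ⟨ σ₂ ⟩)
      criticalPeak {ρ₁} {ρ₂} {σ₁} {σ₂} {p} {u} ρ₁∈R ρ₂∈R u-fun at-p eq =
        subst₂ (λ a b → Peak ρ₁ ρ₂ a b (rhs ρ₂ ⟨ σ₂ ⟩)) (instance₂ (lhs ρ₂) bound-l₂) b-eq
          (subst (Peak ρ₁ ρ₂ (lhs ρ₂ ⟨ μ ⟩ ⟨ δ ⟩) _) (instance₂ (rhs ρ₂) bound-r₂)
            (map-Peak _⟨ δ ⟩ (step-subst δ)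
              (fan (fromFanDiagram (critical ρ₁ ρ₂ ρ₁′ ρ₂ p μ criticalOverlap)))))
        where
        N₁ N₂ N : ℕ
        N₁ = bound (lhs ρ₁) ⊔ bound (rhs ρ₁)
        N₂ = bound (lhs ρ₂) ⊔ bound (rhs ρ₂)
        N  = N₁ ⊔ N₂
        open Swap N

        bound-l₁ : bound (lhs ρ₁) ≤ N
        bound-l₁ = ≤-trans (m≤m⊔n _ _) (m≤m⊔n N₁ N₂)
        bound-r₁ : bound (rhs ρ₁) ≤ N
        bound-r₁ = ≤-trans (m≤n⊔m (bound (lhs ρ₁)) _) (m≤m⊔n N₁ N₂)
        bound-l₂ : bound (lhs ρ₂) ≤ N
        bound-l₂ = ≤-trans (m≤m⊔n _ _) (m≤n⊔m N₁ N₂)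
        bound-r₂ : bound (rhs ρ₂) ≤ N
        bound-r₂ = ≤-trans (m≤n⊔m (bound (lhs ρ₂)) _) (m≤n⊔m N₁ N₂)

        ρ₁′ : Rule
        ρ₁′ = rename swap ρ₁

        -- The variables of `ρ₂` lie below `N`, those of `ρ₁′` do not; on the latter, `swap` undoes
        -- the renaming.
        ν : Subst
        ν x with x <? N
        ... | yes _ = σ₂ x
        ... | no _  = σ₁ (swap x)

        ν-< : ∀ {x} → x < N → ν x ≡ σ₂ x
        ν-< {x} x<N with x <? N
        ... | yes _  = refl
        ... | no x≮N = contradiction x<N x≮N

        ν-swap : ∀ {x} → x < N → ν (swap x) ≡ σ₁ x
        ν-swap {x} x<N with swap x <? N
        ... | yes p = contradiction (subst (_< N) (swap-< x<N) p) (≤⇒≯ (m≤n+m N x))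
        ... | no _  = cong σ₁ (swap-involutive x)

        ν-ρ₂ : ∀ t → bound t ≤ N → t ⟨ ν ⟩ ≡ t ⟨ σ₂ ⟩
        ν-ρ₂ t t≤N = subst-cong t λ x x∈t → ν-< (≤-trans (count⇒<bound x t x∈t) t≤N)

        ν-ρ₁ : ∀ t → bound t ≤ N → t ⟨ var ∘ swap ⟩ ⟨ ν ⟩ ≡ t ⟨ σ₁ ⟩
        ν-ρ₁ t t≤N = trans (subst-∘ t (var ∘ swap) ν)
          (subst-cong t λ x x∈t → ν-swap (≤-trans (count⇒<bound x t x∈t) t≤N))

        occurs-< : ∀ ρ {x} → bound (lhs ρ) ≤ N → bound (rhs ρ) ≤ N → OccursIn x ρ → x < N
        occurs-< ρ {x} l≤N r≤N x∈ρ with 0<m+n⇒0<m⊎0<n (count x (lhs ρ)) x∈ρ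
        ... | inj₁ x∈l = ≤-trans (count⇒<bound x (lhs ρ) x∈l) l≤N
        ... | inj₂ x∈r = ≤-trans (count⇒<bound x (rhs ρ) x∈r) r≤N

        disjoint : ∀ x → OccursIn x ρ₁′ → ¬ OccursIn x ρ₂
        disjoint x x∈ρ₁′ x∈ρ₂ =
          contradiction
            (subst (_< N) (swap-< (occurs-< ρ₂ bound-l₂ bound-r₂ x∈ρ₂))
              (occurs-< ρ₁ bound-l₁ bound-r₁
                (subst (0 <_) (cong₂ _+_ (count-swap x (lhs ρ₁)) (count-swap x (rhs ρ₁))) x∈ρ₁′)))
            (≤⇒≯ (m≤n+m N x))

        linear : ∀ x → count x (lhs ρ₁′) + count x u ≤ 1
        linear x with count x (lhs ρ₁′) in eq₁ | count x u in eq₂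
        ... | zero  | n = ≤-trans (≤-reflexive (sym eq₂))
                            (≤-trans (count-at x (lhs ρ₂) p at-p) (leftLinear ρ₂ ρ₂∈R x))
        ... | suc m | zero = ≤-trans (≤-reflexive (+-identityʳ (suc m)))
                               (≤-trans (≤-reflexive (trans (sym eq₁) (count-swap x (lhs ρ₁))))
                                 (leftLinear ρ₁ ρ₁∈R (swap x)))
        -- A variable shared by `lhs ρ₁′` and `u` would also be shared by `ρ₁′` and `ρ₂`.
        ... | suc m | suc n =
          contradiction
            (m≤n⇒m≤n+o _ (≤-trans (subst (0 <_) (sym eq₂) (s≤s z≤n)) (count-at x (lhs ρ₂) p at-p)))
            (disjoint x (m≤n⇒m≤n+o _ (subst (0 <_) (sym eq₁) (s≤s z≤n))))

        unifies : lhs ρ₁′ ⟨ ν ⟩ ≡ u ⟨ ν ⟩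
        unifies = trans (ν-ρ₁ (lhs ρ₁) bound-l₁) (trans (sym eq) (just-injective
          (trans (sym (at-subst (lhs ρ₂) p σ₂ at-p))
            (trans (cong (_at p) (sym (ν-ρ₂ (lhs ρ₂) bound-l₂))) (at-subst (lhs ρ₂) p ν at-p)))))

        μ,mgu : ∃ λ μ → MGU μ (lhs ρ₁′) u
        μ,mgu = linear-mgu (lhs ρ₁′) u unifies linear

        μ : Subst
        μ = proj₁ μ,mgu

        δ,ν≗ : ∃ λ δ → ∀ x → ν x ≡ μ x ⟨ δ ⟩
        δ,ν≗ = proj₂ (proj₂ μ,mgu) ν unifies

        δ : Subst
        δ = proj₁ δ,ν≗

        criticalOverlap : CriticalOverlap R ρ₁ ρ₂ ρ₁′ ρ₂ p μ
        criticalOverlap = record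
          { ρ₁∈R     = ρ₁∈R
          ; ρ₂∈R     = ρ₂∈R
          ; variant₁ = swap↔ , refl
          ; variant₂ = ↔-id Var , sym (cong₂ _⇒_ (subst-var (lhs ρ₂)) (subst-var (rhs ρ₂)))
          ; disjoint = disjoint
          ; subterm  = u
          ; at-p     = at-p
          ; nonvar   = u-fun
          ; mgu      = proj₂ μ,mgu
          }

        instance-ν : ∀ t → t ⟨ μ ⟩ ⟨ δ ⟩ ≡ t ⟨ ν ⟩
        instance-ν t = trans (subst-∘ t μ δ) (sym (subst-cong t λ x _ → proj₂ δ,ν≗ x))

        instance₂ : ∀ t → bound t ≤ N → t ⟨ μ ⟩ ⟨ δ ⟩ ≡ t ⟨ σ₂ ⟩
        instance₂ t t≤N = trans (instance-ν t) (ν-ρ₂ t t≤N)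

        b-eq : replace (lhs ρ₂ ⟨ μ ⟩) p (rhs ρ₁′ ⟨ μ ⟩) ⟨ δ ⟩ ≡
               replace (lhs ρ₂ ⟨ σ₂ ⟩) p (rhs ρ₁ ⟨ σ₁ ⟩)
        b-eq = trans (replace-subst (lhs ρ₂ ⟨ μ ⟩) p _ δ (at-subst (lhs ρ₂) p μ at-p))
          (cong₂ (λ s t → replace s p t) (instance₂ (lhs ρ₂) bound-l₂)
            (trans (instance-ν (rhs ρ₁′)) (ν-ρ₁ (rhs ρ₁) bound-r₁)))

      rootPeak : ∀ {ρ₁ ρ₂ σ₁ σ₂ p} → R ρ₁ → R ρ₂ → (lhs ρ₂ ⟨ σ₂ ⟩) at p ≡ just (lhs ρ₁ ⟨ σ₁ ⟩) →
        Peak ρ₁ ρ₂ (lhs ρ₂ ⟨ σ₂ ⟩) (replace (lhs ρ₂ ⟨ σ₂ ⟩) p (rhs ρ₁ ⟨ σ₁ ⟩)) (rhs ρ₂ ⟨ σ₂ ⟩)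
      rootPeak {ρ₁} {ρ₂} {σ₁} {σ₂} {p} ρ₁∈R ρ₂∈R at-p with locate (lhs ρ₂) σ₂ p at-p
      ... | inj₁ (u , u-fun , at-u) =
        criticalPeak ρ₁∈R ρ₂∈R u-fun at-u
          (just-injective (trans (sym (at-subst (lhs ρ₂) p σ₂ at-u)) at-p))
      ... | inj₂ (x , q , x∈l , at-q , repl) = variablePeak (count x (rhs ρ₂) ≤? 1)
        where
        y : Term
        y = replace (σ₂ x) q (rhs ρ₁ ⟨ σ₁ ⟩)
        inner : Step R ρ₁ (σ₂ x) y
        inner = ρ₁∈R , q , σ₁ , at-q , refl
        b-eq : replace (lhs ρ₂ ⟨ σ₂ ⟩) p (rhs ρ₁ ⟨ σ₁ ⟩) ≡ lhs ρ₂ ⟨ update σ₂ x y ⟩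
        -- By left-linearity the inner step changes the only copy of `σ₂ x`, so the result is again
        -- an instance of `lhs ρ₂`.
        b-eq = repl (leftLinear ρ₂ ρ₂∈R x) _
        outer : Step R ρ₂ (replace (lhs ρ₂ ⟨ σ₂ ⟩) p (rhs ρ₁ ⟨ σ₁ ⟩)) (rhs ρ₂ ⟨ update σ₂ x y ⟩)
        outer = ρ₂∈R , [] , update σ₂ x y , cong just b-eq , refl
        variablePeak : _ → Peak ρ₁ ρ₂ _ _ _
        variablePeak (yes linear) =
          valley (ρ₁ , ρ₁∈R , p , σ₁ , at-p , refl) (ρ₂ , ρ₂∈R , [] , σ₂ , refl , refl)
                 (inj₂ outer) (step-update inner (rhs ρ₂) linear)
        variablePeak (no ¬linear) =
          -- At least two occurrences of `x` on the right against at most one on the left.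
          dup₂ (x , ≤-<-trans (leftLinear ρ₂ ρ₂∈R x) (≰⇒> ¬linear)) outer
               (Star.map (ρ₁ ,_) (steps-update inner (rhs ρ₂)))

      -- Recursion strips the common prefix of the positions, until one is empty or they diverge and
      -- the steps commute.
      peakAt : ∀ {ρ₁ ρ₂ σ₁ σ₂} → R ρ₁ → R ρ₂ → ∀ a p₁ p₂ →
               a at p₁ ≡ just (lhs ρ₁ ⟨ σ₁ ⟩) → a at p₂ ≡ just (lhs ρ₂ ⟨ σ₂ ⟩) →
               Peak ρ₁ ρ₂ a (replace a p₁ (rhs ρ₁ ⟨ σ₁ ⟩)) (replace a p₂ (rhs ρ₂ ⟨ σ₂ ⟩))
      peakAt ρ₁∈R ρ₂∈R a p₁ [] at₁ refl = rootPeak ρ₁∈R ρ₂∈R at₁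
      peakAt ρ₁∈R ρ₂∈R a [] p₂@(_ ∷ _) refl at₂ = flip-Peak (rootPeak ρ₂∈R ρ₁∈R at₂)
      peakAt {ρ₁} {ρ₂} {σ₁} {σ₂} ρ₁∈R ρ₂∈R (fun f ts) (j ∷ p₁) (k ∷ p₂) at₁ at₂ with j ≟ k
      ... | no j≢k =
        valley (ρ₁ , ρ₁∈R , j ∷ p₁ , σ₁ , at₁ , refl) (ρ₂ , ρ₂∈R , k ∷ p₂ , σ₂ , at₂ , refl)
          (inj₂ (ρ₂∈R , k ∷ p₂ , σ₂ , trans (atVec-parallel ts p₁ p₂ _ j≢k) at₂ , refl))
          (inj₂ (ρ₁∈R , j ∷ p₁ , σ₁ , trans (atVec-parallel ts p₂ p₁ _ (j≢k ∘ sym)) at₁ ,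
                 cong (fun f) (replaceVec-comm ts p₁ p₂ _ _ j≢k)))
      ... | yes refl with atVec-split ts j p₁ at₁ | atVec-split ts j p₂ at₂
      ...   | t , at-j , at-p₁ , repl₁ | t′ , at-j′ , at-p₂ , repl₂
        with just-injective (trans (sym at-j) at-j′)
      -- Both results become `F` of a contracted `t`, so the peak at `t` can be lifted through the
      -- context `F`.
      ...     | refl rewrite repl₁ (rhs ρ₁ ⟨ σ₁ ⟩) | repl₂ (rhs ρ₂ ⟨ σ₂ ⟩) =
        subst (λ us → Peak ρ₁ ρ₂ (fun f us) (F (replace t p₁ (rhs ρ₁ ⟨ σ₁ ⟩)))
                                            (F (replace t p₂ (rhs ρ₂ ⟨ σ₂ ⟩))))
          (replaceVec-self ts j at-j)
          (map-Peak F (step-hole f ts j at-j) (peakAt ρ₁∈R ρ₂∈R t p₁ p₂ at-p₁ at-p₂))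
        where
        F : Term → Term
        F y = fun f (replaceVec ts j [] y)

      localPeak : ∀ {ρ₁ ρ₂ a b c} → Step R ρ₁ a b → Step R ρ₂ a c → Peak ρ₁ ρ₂ a b c
      localPeak {a = a} (ρ₁∈R , p₁ , _ , at₁ , refl) (ρ₂∈R , p₂ , _ , at₂ , refl) =
        peakAt ρ₁∈R ρ₂∈R a p₁ p₂ at₁ at₂

      -- Confluence at a term by labelling what it reaches.

      ConfluentAt : Term → Set
      ConfluentAt s = ∀ {t u} → R ⊢ s ⟶* t → R ⊢ s ⟶* u → ∃ λ v → (R ⊢ t ⟶* v) × (R ⊢ u ⟶* v)

      module From (s : Term)
                  (ih : ∀ {t} → RelStep (DupRules R) (NonDupRules R) s t → ConfluentAt t) where

        -- After one relative step the reduction is unrestricted, so smallness is closed under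
        -- rewriting and `ih` at `t` gives confluence at `a`.
        Small : Term → Set
        Small a = ∃ λ t → RelStep (DupRules R) (NonDupRules R) s t × R ⊢ t ⟶* a

        small-⟶* : ∀ {a b} → Small a → R ⊢ a ⟶* b → Small b
        small-⟶* (t , s>t , r) r′ = t , s>t , r ◅◅ r′

        small-confluent : ∀ {a} → Small a → ConfluentAt a
        small-confluent (t , s>t , r) r₁ r₂ = ih s>t (r ◅◅ r₁) (r ◅◅ r₂)

        dup-step-small : ∀ {ρ a b} → NonDupRules R ⊢ s ⟶* a → Step R ρ a b → Duplicating ρ → Small b
        dup-step-small {ρ} r (ρ∈R , st) dup = _ , (_ , _ , r , (ρ , (ρ∈R , dup) , st) , ε) , ε

        -- The reduction is cut at its first duplicating step, which completes a relative step from
        -- `s`.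
        classify : ∀ {a b} → NonDupRules R ⊢ s ⟶* a → R ⊢ a ⟶* b →
                   NonDupRules R ⊢ s ⟶* b ⊎ Small b
        classify r ε = inj₁ r
        classify r ((ρ , st@(ρ∈R , at)) ◅ r′) with duplicating? ρ
        ... | yes dup = inj₂ (small-⟶* (dup-step-small r st dup) r′)
        ... | no ¬dup = classify (r ◅◅ (ρ , (ρ∈R , ¬dup) , at) ◅ ε) r′

        -- Either the step itself is the first duplicating one, or an earlier one has made `a` small
        -- already.
        dup-small : ∀ {ρ a b} → R ⊢ s ⟶* a → Step R ρ a b → Duplicating ρ → Small b
        dup-small r st dup with classify ε r
        ... | inj₁ r′ = dup-step-small r′ st dup
        ... | inj₂ sm = small-⟶* sm ((_ , st) ◅ ε)

        -- The constructors overlap: steps of given diagrams receive their rule label without a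
        -- decision on smallness.
        data Label : ℕ → Term → Term → Set where
          small : ∀ {a b} → Small a → R ⊢ a ⟶ b → Label 0 a b
          rule  : ∀ {ρ a b} → R ⊢ s ⟶* a → Step R ρ a b → Label (suc (i ρ)) a b

        open Labelled Label

        small-Red : ∀ {k a b} → 0 < k → Small a → R ⊢ a ⟶* b → Red k a b
        small-Red 0<k sm ε        = ε
        small-Red 0<k sm (st ◅ r) = (0 , 0<k , small sm st) ◅ small-Red 0<k (small-⟶* sm (st ◅ ε)) r

        Label⇒⟶ : ∀ {n a b} → Label n a b → R ⊢ a ⟶ b
        Label⇒⟶ (small _ st) = st
        Label⇒⟶ (rule _ st)  = _ , st

        Red⇒⟶* : ∀ {k a b} → Red k a b → R ⊢ a ⟶* b
        Red⇒⟶* = Star.map λ (_ , _ , st) → Label⇒⟶ st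

        -- The only label below 1 is 0, so each backward step has a small source, at which the
        -- induction hypothesis closes the peak.
        base : ChurchRosser 1
        base ε = _ , ε , ε
        base (fwd st ◅ c) with base c
        ... | d , r₁ , r₂ = d , st ◅ r₁ , r₂
        base (bwd (_ , s≤s z≤n , small sm st) ◅ c) with base c
        ... | d , r₁ , r₂ with small-confluent sm (st ◅ ε) (Red⇒⟶* r₁)
        ...   | v , r₃ , r₄ =
          v , small-Red ≤-refl (small-⟶* sm (st ◅ ε)) r₃ ,
          r₂ ◅◅ small-Red ≤-refl (small-⟶* sm (Red⇒⟶* r₁)) r₄

        fromReached : ∀ {a} → R ⊢ s ⟶* a → ∀ {n x y} → Reached a n x y → Label n x y
        fromReached r (reached r′ st) = rule (r ◅◅ r′) st

        -- `c` is small as the result of a duplicating step. Hence `c ⟶* d`, however long, carries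
        -- label 0 and fits into the last conversion.
        dup-Diagram : ∀ {m ρ a b c d} → R ⊢ s ⟶* a → R ⊢ a ⟶ b → Step R ρ a c → Duplicating ρ →
                      Step R ρ b d → R ⊢ c ⟶* d → Diagram m (suc (i ρ)) b c
        dup-Diagram {d = d} r a⟶b a⟶c dup b⟶d c⟶*d =
          _ , d , d , d , ε , inj₂ (_ , ≤-refl , rule (r ◅◅ a⟶b ◅ ε) b⟶d) , ε , inj₁ refl ,
          reverse (Red⇒Conv (small-Red (s≤s z≤n) (dup-small r a⟶c dup) c⟶*d))

        peak : ∀ {m n a b c} → m ≤ n → 0 < n → Label m a b → Label n a c → Diagram m n b c
        -- Both results of the peak are small, so the joining reductions have label 0 and together
        -- form the middle conversion.
        peak _ 0<n (small sm st₁) st₂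
          with small-confluent sm (st₁ ◅ ε) (Label⇒⟶ st₂ ◅ ε)
        ... | v , r₁ , r₂ =
          _ , _ , _ , _ , ε , inj₁ refl ,
          Red⇒Conv (small-Red 0<n (small-⟶* sm (st₁ ◅ ε)) r₁) ◅◅
          reverse (Red⇒Conv (small-Red 0<n (small-⟶* sm (Label⇒⟶ st₂ ◅ ε)) r₂)) ,
          inj₁ refl , ε
        peak _ () (rule _ _) (small _ _)
        peak _ _ (rule r st₁) (rule _ st₂) with localPeak st₁ st₂
        ... | fan d           = map-Diagram id (fromReached r) d
        ... | dup₁ dup st c⟶d = flip-Diagram (dup-Diagram r (_ , st₂) st₁ dup st c⟶d)
        ... | dup₂ dup st c⟶d = dup-Diagram r (_ , st₁) st₂ dup st c⟶d

        open Decreasing Label base peak using (churchRosser)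

        -- The rule labels may be unbounded over `R`, so each reduction gets a bound of its own.
        ⟶*⇒Red : ∀ {a b} → R ⊢ s ⟶* a → R ⊢ a ⟶* b → ∃ λ k → Red k a b
        ⟶*⇒Red r ε = 0 , ε
        ⟶*⇒Red r (st@(ρ , st′) ◅ r′) with ⟶*⇒Red (r ◅◅ st ◅ ε) r′
        ... | k , red = suc (suc (i ρ)) ⊔ k ,
          (_ , m≤m⊔n _ k , rule r st′) ◅ weakenRed (m≤n⊔m (suc (suc (i ρ))) k) red

        confluentAt : ConfluentAt s
        confluentAt r₁ r₂ with ⟶*⇒Red ε r₁ | ⟶*⇒Red ε r₂
        ... | k , red₁ | l , red₂
          with churchRosser (k ⊔ l)
                 (reverse (weaken (m≤m⊔n k l) (Red⇒Conv red₁)) ◅◅ weaken (m≤n⊔m k l) (Red⇒Conv red₂))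
        ...   | v , r₃ , r₄ = v , Red⇒⟶* r₃ , Red⇒⟶* r₄

      confluentAt : ∀ s → Acc (λ t s → RelStep (DupRules R) (NonDupRules R) s t) s → ConfluentAt s
      confluentAt s (acc rs) = From.confluentAt s λ s>t → confluentAt _ (rs s>t)

theorem5p10 : (Sig : Signature) → let open Rewriting Sig in
    (R : TRS) →
    LeftLinear R →
    RelTerminating (DupRules R) (NonDupRules R) →
    Σ (Rule → ℕ) (λ i → CriticalPeaksDecreasingFan R i) →
    Confluent R
theorem5p10 Sig R leftLinear terminating (i , critical) {s} =
  Peaks.confluentAt Sig R i leftLinear critical s (terminating s)
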